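{- Let $N>n\ge 3$. A pair $(S,w)$ is valid in $K_N$ with all edge weights at most one if and only if there exists an assignment to variables $y=(y_{W,I})$ such that $\{S,w,y\}$ is a feasible solution to the following system $\mathrm{ILP}_{N,n}$: for all $\varnothing\ne I\subseteq[n]$ and all cuts $W\subseteq[N-1]$ in $K_N$ such that $I=W\cap[n]$, $$S_I\le\|C(W)\|,$$ $$\|C(W)\|\le S_I+|W|\,(N-|W|)\,y_{W,I},$$ $$\sum_{W\cap[n]=I}y_{W,I}=2^{N-|I|-1}-1,$$ $$y_{W,I}\in\{0,1\},$$ $$0\le w(e)\le 1\quad\text{for all } e\in E_N.$$
   Context: For a positive integer $k$ let $[k]=\{1,\dots,k\}$. $K_N$ is the undirected complete graph on vertex set $[N]$, with edge set $E_N=\{(i,j):1\le i<j\le N\}$. For edge weights $w=(w(e))_{e\in E_N}$ and $W\subseteq[N]$, the cut $C(W)$ is the set of edges with exactly one endpoint in $W$, and $\|C(W)\|=\sum_{e\in C(W)}w(e)$ is its total weight. The vertices in $[n]$ are terminals and vertex $N$ is the sink. The pair $(S,w)$ with $S=(S_I)_{\varnothing\ne I\subseteq[n]}$ is a valid pair in $K_N$ (that is, $w$ realizes $S$ in $K_N$) if $w\ge 0$ and $S_I=\min\{\|C(W)\| : W\subseteq[N-1],\ W\cap[n]=I\}$ for every $\varnothing\ne I\subseteq[n]$. For each $\varnothing\ne I\subseteq[n]$, the number of cuts $W\subseteq[N-1]$ in $K_N$ that contain $I$ is $2^{N-|I|-1}$; for each such $W$ and $I$ a binary variable $y_{W,I}$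 is introduced.
   Formalization: The right-hand side 2^{N-|I|-1}-1 of the counting constraint is replaced by 2^{N-n-1}-1, the number of cuts W with W∩[n]=I minus one; as printed the system is infeasible for |I|=1, although S=0, w=0 is valid. -}

module Defs where

open import Algebra.Bundles using (CommutativeRing)
import Algebra.Definitions.RawMonoid as RawMonoid
open import Data.Bool.Properties using () renaming (_≟_ to _≟ᵇ_)
open import Data.Fin.Base using (Fin; toℕ; _<_)
open import Data.Fin.Properties using (_<?_)
open import Data.Fin.Subset
  using (Subset; inside; outside; _∈_; _∉_; _⊆_; _∩_; ∣_∣; Nonempty)
open import Data.Fin.Subset.Properties using (_∈?_; _⊆?_)
open import Data.Irrelevant using ([_])
open import Data.List.Base
  using (List; []; _∷_; _++_; map; foldr; filter; mapMaybe; allFin; cartesianProduct)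
open import Data.Maybe.Base using (Maybe; just; nothing)
open import Data.Nat.Base as ℕ using (ℕ; zero; suc; _∸_; _^_)
import Data.Nat.Properties as ℕ
open import Data.Product.Base using (_×_; _,_; proj₁; proj₂; ∃-syntax)
open import Data.Refinement.Base using (Refinement-syntax; _,_)
open import Data.Sum.Base using (_⊎_)
open import Data.Vec.Base using (tabulate; []; _∷_)
open import Data.Vec.Properties using (≡-dec)
open import Level using (_⊔_) renaming (suc to lsuc)
open import Relation.Binary.Core using (Rel)
open import Relation.Binary.PropositionalEquality.Core using (_≡_)
open import Relation.Binary.Structures using (IsTotalOrder)
open import Relation.Nullary using (¬_; Dec; yes; no; does; ¬?; _×-dec_; _⊎-dec_)
open import Relation.Unary using (Pred)

-- The library has neither the real numbers nor ordered fields; weights are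
-- taken in an arbitrary totally ordered field.

record OrderedField c ℓ₁ ℓ₂ : Set (lsuc (c ⊔ ℓ₁ ⊔ ℓ₂)) where
  infix 4 _≤_
  field
    commutativeRing : CommutativeRing c ℓ₁
  open CommutativeRing commutativeRing public
  field
    _≤_          : Rel Carrier ℓ₂
    isTotalOrder : IsTotalOrder _≈_ _≤_
    0≉1          : ¬ (0# ≈ 1#)
    inverse      : ∀ x → ¬ (x ≈ 0#) → ∃[ x⁻¹ ] x * x⁻¹ ≈ 1#
    +-monoˡ-≤    : ∀ z {x y} → x ≤ y → x + z ≤ y + z
    *-nonNeg     : ∀ {x y} → 0# ≤ x → 0# ≤ y → 0# ≤ x * y

-- The paper's vertex i ∈ {1,…,N} is the element of Fin N whose toℕ is i - 1.
-- Thus first k is the paper's [k], for k ≤ N, and the sink N is the one vertex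
-- outside first (N ∸ 1).

first : ∀ {N} → ℕ → Subset N
first k = tabulate λ i → does (toℕ i ℕ.<? k)

subsets : ∀ N → List (Subset N)
subsets zero    = [] ∷ []
subsets (suc N) = map (outside ∷_) (subsets N) ++ map (inside ∷_) (subsets N)

Edge : ℕ → Set
Edge N = [ e ∈ Fin N × Fin N ∣ proj₁ e < proj₂ e ]

edges : ∀ N → List (Edge N)
edges N = mapMaybe edge? (cartesianProduct (allFin N) (allFin N))
  where
  edge? : Fin N × Fin N → Maybe (Edge N)
  edge? (i , j) with i <? j
  ... | yes i<j = just ((i , j) , [ i<j ])
  ... | no  _   = nothing

Crosses : ∀ {N} → Subset N → Edge N → Set
Crosses W ((i , j) , _) = (i ∈ W × j ∉ W) ⊎ (i ∉ W × j ∈ W)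

crosses? : ∀ {N} (W : Subset N) (e : Edge N) → Dec (Crosses W e)
crosses? W ((i , j) , _) =
  ((i ∈? W) ×-dec ¬? (j ∈? W)) ⊎-dec (¬? (i ∈? W) ×-dec (j ∈? W))

C : ∀ {N} → Subset N → List (Edge N)
C W = filter (crosses? W) (edges _)

-- The index sets ∅ ≠ I ⊆ [n], as subsets of the vertex set.

record TerminalSet (N n : ℕ) : Set where
  constructor terminalSet
  field
    set        : Subset N
    .nonempty  : Nonempty set
    .terminals : set ⊆ first n

open TerminalSet public using (set)

CutFor : ∀ {N n} → TerminalSet N n → Subset N → Set
CutFor {N} {n} I W = W ⊆ first (N ∸ 1) × W ∩ first n ≡ set I

cutFor? : ∀ {N n} (I : TerminalSet N n) (W : Subset N) → Dec (CutFor I W)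
cutFor? {N} {n} I W = (W ⊆? first (N ∸ 1)) ×-dec ≡-dec _≟ᵇ_ (W ∩ first n) (set I)

cutsFor : ∀ {N n} → TerminalSet N n → List (Subset N)
cutsFor I = filter (cutFor? I) (subsets _)

module Network {c ℓ₁ ℓ₂} (F : OrderedField c ℓ₁ ℓ₂) where

  open OrderedField F
  open RawMonoid +-rawMonoid using () renaming (_×_ to _·_)

  fromℕ : ℕ → Carrier
  fromℕ m = m · 1#

  ∑ : ∀ {a} {A : Set a} → List A → (A → Carrier) → Carrier
  ∑ xs f = foldr (λ x s → f x + s) 0# xs

  IsMinimum : ∀ {p} → Pred Carrier p → Carrier → Set (c ⊔ ℓ₂ ⊔ p)
  IsMinimum P m = P m × (∀ x → P x → m ≤ x)

  Weights : ℕ → Set c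
  Weights N = Edge N → Carrier

  ‖C_‖ : ∀ {N} → Subset N → Weights N → Carrier
  ‖C W ‖ w = ∑ (C W) w

  record Valid {N n} (S : TerminalSet N n → Carrier) (w : Weights N)
               : Set (c ⊔ ℓ₁ ⊔ ℓ₂) where
    field
      nonNeg  : ∀ e → 0# ≤ w e
      minimum : ∀ I → IsMinimum (λ x → ∃[ W ] CutFor I W × x ≈ ‖C W ‖ w) (S I)

  -- Only the values y W I with CutFor I W are constrained; the others play
  -- no role.

  record ILP {N n} (S : TerminalSet N n → Carrier) (w : Weights N)
             (y : Subset N → TerminalSet N n → Carrier) : Set (c ⊔ ℓ₁ ⊔ ℓ₂) where
    field
      lower  : ∀ I W → CutFor I W → S I ≤ ‖C W ‖ w
      upper  : ∀ I W → CutFor I W →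
               ‖C W ‖ w ≤ S I + fromℕ (∣ W ∣ ℕ.* (N ∸ ∣ W ∣)) * y W I
      -- For n < N there are 2 ^ (N ∸ n ∸ 1) sets W with CutFor I W (each of the
      -- N ∸ n ∸ 1 vertices that are neither terminals nor the sink is free), so
      -- for binary y exactly one of the y W I vanishes.  The exponent
      -- N ∸ ∣ I ∣ ∸ 1 would instead count the W that merely include I; with it
      -- the system has no solution when 3 ≤ n < N.
      count  : ∀ I → ∑ (cutsFor I) (λ W → y W I) ≈ fromℕ (2 ^ (N ∸ n ∸ 1) ∸ 1)
      binary : ∀ I W → CutFor I W → y W I ≈ 0# ⊎ y W I ≈ 1#
      bounds : ∀ e → 0# ≤ w e × w e ≤ 1#

{-# OPTIONS --safe #-}

-- If w realizes S, put y W I = 0 at one chosen minimum cut for I and y W I = 1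
-- at all other cuts: the upper bound then holds with equality at the chosen cut,
-- and elsewhere because ‖C W‖ is at most the number ∣W∣ (N - ∣W∣) of edges of
-- the cut while S I ≥ 0.  Conversely, were y equal to 1 at all 2^(N-n-1) cuts for
-- I, the count would give 1 = 0; so y vanishes at some cut, where the two bounds
-- force S I = ‖C W‖.

module Submission where

import Algebra.Properties.CommutativeMonoid.Sum as Sum
import Algebra.Properties.Ring as RingProperties
open import Data.Bool.Base using (Bool; true; false; if_then_else_; not; _∧_; _∨_)
open import Data.Bool.Properties using (∧-zeroʳ; ∨-identityʳ) renaming (_≟_ to _≟ᵇ_)
open import Data.Fin.Base using (Fin; zero; suc)
open import Data.Fin.Properties using (_<?_)
open import Data.Fin.Subset using (Subset; inside; outside; _⊆_; _∩_; ∣_∣)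
open import Data.Fin.Subset.Properties
  using (_∈?_; _⊆?_; out⊆; in⊆in; drop-∷-⊆; ∣p∣≤n; p⊆q⇒∣p∣≤∣q∣)
open import Data.List.Base
  using (List; []; _∷_; _++_; map; filter; filterᵇ; length; mapMaybe; tabulate; allFin;
         cartesianProduct)
open import Data.List.Membership.Propositional using (_∈_)
open import Data.List.Membership.Propositional.Properties
  using (∈-map⁺; ∈-map⁻; ∈-++⁺ˡ; ∈-++⁺ʳ; ∈-filter⁺)
open import Data.List.Properties using (filter-++; length-++)
open import Data.List.Relation.Unary.All using (All; []; _∷_)
import Data.List.Relation.Unary.All as All
open import Data.List.Relation.Unary.All.Properties using (all-filter)
open import Data.List.Relation.Unary.Any using (here; there)
open import Data.List.Relation.Unary.Unique.Propositional using (Unique; []; _∷_)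
import Data.List.Relation.Unary.Unique.Propositional.Properties as Unique
open import Data.Maybe.Base using (Maybe)
open import Data.Nat.Base as ℕ using (ℕ; zero; suc; z≤n; s≤s; _∸_; _^_; _<_) renaming (_≤_ to _≤ℕ_)
import Data.Nat.Properties as ℕ
open import Data.Product.Base using (_×_; _,_; proj₁; proj₂; ∃-syntax)
open import Data.Sum.Base using (_⊎_; inj₁; inj₂)
open import Data.Vec.Base using ([]; _∷_; here)
open import Data.Vec.Properties using (≡-dec; ∷-injectiveʳ)
open import Function.Base using (_∘_; case_of_; id)
open import Function.Bundles using (_⇔_; mk⇔)
open import Relation.Binary.Bundles using (Poset)
open import Relation.Binary.PropositionalEquality
  using (_≡_; _≢_; _≗_; refl; sym; trans; cong; cong₂; module ≡-Reasoning)
import Relation.Binary.Reasoning.PartialOrder as PosetReasoning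
open import Relation.Binary.Structures using (IsTotalOrder)
open import Relation.Nullary using (Dec; yes; no; does; contradiction; recompute; _×-dec_; T?)
open import Relation.Nullary.Decidable using (dec-true; dec-false)
open import Relation.Unary using (Pred; Decidable)

open import Defs

open Sum ℕ.+-0-commutativeMonoid using (sum; sum-cong-≗)

private
  variable
    N : ℕ

-- Counting the entries of a list that satisfy a predicate

[_]ᵇ : Bool → ℕ
[ b ]ᵇ = if b then 1 else 0

module _ {a} {A : Set a} where

  length-filter-map : ∀ {b p} {B : Set b} {P : Pred B p} (P? : Decidable P) (f : A → B) xs →
    length (filter P? (map f xs)) ≡ length (filter (P? ∘ f) xs)
  length-filter-map P? f []       = refl
  length-filter-map P? f (x ∷ xs) with does (P? (f x))
  ... | true  = cong suc (length-filter-map P? f xs)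
  ... | false = length-filter-map P? f xs

  length-filter-++ : ∀ {p} {P : Pred A p} (P? : Decidable P) xs ys →
    length (filter P? (xs ++ ys)) ≡ length (filter P? xs) ℕ.+ length (filter P? ys)
  length-filter-++ P? xs ys =
    trans (cong length (filter-++ P? xs ys)) (length-++ (filter P? xs))

  -- Only the Boolean answers are compared, so at concrete head bits the hypothesis for `restricts?`
  -- holds by computation, with no equivalence of propositions to prove.
  length-filter-cong : ∀ {p q} {P : Pred A p} {Q : Pred A q}
    (P? : Decidable P) (Q? : Decidable Q) → does ∘ P? ≗ does ∘ Q? →
    ∀ xs → length (filter P? xs) ≡ length (filter Q? xs)
  length-filter-cong P? Q? eq []       = refl
  length-filter-cong P? Q? eq (x ∷ xs) with does (P? x) | does (Q? x) | eq x
  ... | true  | _ | refl = cong suc (length-filter-cong P? Q? eq xs)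
  ... | false | _ | refl = length-filter-cong P? Q? eq xs

  length-filter-none : ∀ {p} {P : Pred A p} (P? : Decidable P) →
    (∀ x → does (P? x) ≡ false) → ∀ xs → length (filter P? xs) ≡ 0
  length-filter-none P? eq []       = refl
  length-filter-none P? eq (x ∷ xs) with does (P? x) | eq x
  ... | false | _ = length-filter-none P? eq xs

  length-filter-tabulate : ∀ {p} {P : Pred A p} (P? : Decidable P) {n} (f : Fin n → A) →
    length (filter P? (tabulate f)) ≡ sum (λ i → [ does (P? (f i)) ]ᵇ)
  length-filter-tabulate P? {zero}  f = refl
  length-filter-tabulate P? {suc n} f with does (P? (f zero))
  ... | true  = cong suc (length-filter-tabulate P? (f ∘ suc))
  ... | false = length-filter-tabulate P? (f ∘ suc)

-- The first factor is a general `tabulate f` because the induction leaves `allFin`: the tail of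
-- `tabulate id` is `tabulate suc`.
length-filter-cartesianProduct : ∀ {a b p} {A : Set a} {B : Set b} {P : Pred (A × B) p}
  (P? : Decidable P) {m} (f : Fin m → A) (ys : List B) →
  length (filter P? (cartesianProduct (tabulate f) ys)) ≡
  sum (λ i → length (filter (λ y → P? (f i , y)) ys))
length-filter-cartesianProduct P? {zero}  f ys = refl
length-filter-cartesianProduct P? {suc m} f ys = begin
  length (filter P? (map (f zero ,_) ys ++ rest))
    ≡⟨ length-filter-++ P? (map (f zero ,_) ys) rest ⟩
  length (filter P? (map (f zero ,_) ys)) ℕ.+ length (filter P? rest)
    ≡⟨ cong₂ ℕ._+_ (length-filter-map P? (f zero ,_) ys)
                   (length-filter-cartesianProduct P? (f ∘ suc) ys) ⟩
  sum (λ i → length (filter (λ y → P? (f i , y)) ys)) ∎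
  where
  open ≡-Reasoning
  rest = cartesianProduct (tabulate (f ∘ suc)) ys

-- The size of a cut

-- The function by which edges N selects its edges is local to the definition of
-- edges; unification recovers it.
edges-unfold : ∀ N →
  ∃[ edge? ] edges N ≡ mapMaybe edge? (cartesianProduct (allFin N) (allFin N))
edges-unfold N = _ , refl

edge? : ∀ N → Fin N × Fin N → Maybe (Edge N)
edge? N = proj₁ (edges-unfold N)

-- This is the Boolean to which `does (crosses? W e)` reduces for an edge `e` from `i` to `j`.
-- Depending on the endpoints alone, it also makes sense for pairs without `i < j`.
crossesᵇ : Subset N → Fin N → Fin N → Bool
crossesᵇ W i j = (does (i ∈? W) ∧ not (does (j ∈? W))) ∨ (not (does (i ∈? W)) ∧ does (j ∈? W))

orderedCrossesᵇ : Subset N → Fin N × Fin N → Bool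
orderedCrossesᵇ W (i , j) = does (i <? j) ∧ crossesᵇ W i j

-- The test `i < j` that selects the edges becomes a conjunct of the predicate. The count then runs
-- over a full square of ordered pairs and can be written as a double sum.
length-filter-edge? : (W : Subset N) → ∀ ps →
  length (filter (crosses? W) (mapMaybe (edge? N) ps)) ≡
  length (filterᵇ (orderedCrossesᵇ W) ps)
length-filter-edge? W []             = refl
length-filter-edge? W ((i , j) ∷ ps) with i <? j
... | no i≮j  rewrite dec-false (i <? j) i≮j = length-filter-edge? W ps
... | yes i<j rewrite dec-true (i <? j) i<j with crossesᵇ W i j
...   | true  = cong suc (length-filter-edge? W ps)
...   | false = length-filter-edge? W ps

crossings : Subset N → ℕ
crossings W = sum λ i → sum λ j → [ orderedCrossesᵇ W (i , j) ]ᵇ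

length-C : (W : Subset N) → length (C W) ≡ crossings W
length-C {N} W = begin
  length (C W)
    ≡⟨ length-filter-edge? W (cartesianProduct (allFin N) (allFin N)) ⟩
  length (filterᵇ (orderedCrossesᵇ W) (cartesianProduct (allFin N) (allFin N)))
    ≡⟨ length-filter-cartesianProduct (T? ∘ orderedCrossesᵇ W) id (allFin N) ⟩
  sum (λ i → length (filterᵇ (λ j → orderedCrossesᵇ W (i , j)) (allFin N)))
    ≡⟨ sum-cong-≗ (λ i → length-filter-tabulate (λ j → T? (orderedCrossesᵇ W (i , j))) id) ⟩
  crossings W ∎
  where open ≡-Reasoning

sum-∈ : (p : Subset N) → sum (λ j → [ does (j ∈? p) ]ᵇ) ≡ ∣ p ∣
sum-∈ []            = refl
sum-∈ (inside  ∷ p) = cong suc (sum-∈ p)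
sum-∈ (outside ∷ p) = sum-∈ p

sum-∉ : (p : Subset N) → sum (λ j → [ not (does (j ∈? p)) ]ᵇ) ≡ N ∸ ∣ p ∣
sum-∉ []            = refl
sum-∉ (inside  ∷ p) = sum-∉ p
-- Moving `suc` into the truncated subtraction needs `∣ p ∣ ≤ N`.
sum-∉ (outside ∷ p) = trans (cong suc (sum-∉ p)) (sym (ℕ.+-∸-assoc 1 (∣p∣≤n p)))

-- Vertex `zero` is the smaller endpoint of all its pairs, so its row counts the later vertices on
-- the other side: `N ∸ ∣ W ∣` of them if it lies inside, `∣ W ∣` if outside, where `W` is the tail.
-- The other rows form `crossings W`. In the inside case the product unfolds to exactly this sum.
crossings-size : (W : Subset N) → crossings W ≡ ∣ W ∣ ℕ.* (N ∸ ∣ W ∣)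
crossings-size []                    = refl
crossings-size {suc N} (inside  ∷ W) = cong₂ ℕ._+_
  (trans (sum-cong-≗ (λ j → cong [_]ᵇ (∨-identityʳ (not (does (j ∈? W)))))) (sum-∉ W))
  (crossings-size W)
crossings-size {suc N} (outside ∷ W) = begin
  sum (λ j → [ does (j ∈? W) ]ᵇ) ℕ.+ crossings W  ≡⟨ cong₂ ℕ._+_ (sum-∈ W) (crossings-size W) ⟩
  ∣ W ∣ ℕ.+ ∣ W ∣ ℕ.* (N ∸ ∣ W ∣)                 ≡⟨ ℕ.*-suc ∣ W ∣ (N ∸ ∣ W ∣) ⟨
  ∣ W ∣ ℕ.* suc (N ∸ ∣ W ∣)                       ≡⟨ cong (∣ W ∣ ℕ.*_) (ℕ.+-∸-assoc 1 (∣p∣≤n W)) ⟨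
  ∣ W ∣ ℕ.* (suc N ∸ ∣ W ∣)                       ∎
  where open ≡-Reasoning

cut-size : (W : Subset N) → length (C W) ≡ ∣ W ∣ ℕ.* (N ∸ ∣ W ∣)
cut-size W = trans (length-C W) (crossings-size W)

-- The number of cuts for a terminal set

∈-subsets : (W : Subset N) → W ∈ subsets N
∈-subsets []            = here refl
∈-subsets (outside ∷ W) = ∈-++⁺ˡ (∈-map⁺ _ (∈-subsets W))
∈-subsets (inside  ∷ W) = ∈-++⁺ʳ _ (∈-map⁺ _ (∈-subsets W))

-- Filtering preserves uniqueness, so the chosen minimum cut occurs only once in `cutsFor I` and
-- contributes the only zero to the count.
subsets-unique : ∀ N → Unique (subsets N)
subsets-unique zero    = [] ∷ []
subsets-unique (suc N) = Unique.++⁺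
  (Unique.map⁺ ∷-injectiveʳ (subsets-unique N))
  (Unique.map⁺ ∷-injectiveʳ (subsets-unique N))
  λ (∈out , ∈in) → case ∈-map⁻ _ ∈out , ∈-map⁻ _ ∈in of λ where
    ((_ , _ , refl) , (_ , _ , ()))

∣first∣ : ∀ {k} → k ≤ℕ N → ∣ first {N} k ∣ ≡ k
∣first∣ {zero}  z≤n       = refl
∣first∣ {suc N} z≤n       = ∣first∣ {N} z≤n
∣first∣ {suc N} (s≤s k≤N) = cong suc (∣first∣ k≤N)

first-mono : ∀ {k l} → k ≤ℕ l → first {N} k ⊆ first l
first-mono {zero}                  _         ()
first-mono {suc N} {l = zero}      z≤n       = out⊆ (first-mono {N} {l = zero} z≤n)
first-mono {suc N} {l = suc l}     z≤n       = out⊆ (first-mono {N} {l = l} z≤n)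
first-mono {suc N}                 (s≤s k≤l) = in⊆in (first-mono k≤l)

-- This is `cutFor?` with both initial segments replaced by arbitrary sets, so that an induction can
-- drop the first vertex from all of them at once.
restricts? : (A B I W : Subset N) → Dec (W ⊆ A × W ∩ B ≡ I)
restricts? A B I W = (W ⊆? A) ×-dec ≡-dec _≟ᵇ_ (W ∩ B) I

length-filter-subsets : ∀ {p} {P : Pred (Subset (suc N)) p} (P? : Decidable P) →
  length (filter P? (subsets (suc N))) ≡
  length (filter (P? ∘ (outside ∷_)) (subsets N)) ℕ.+ length (filter (P? ∘ (inside ∷_)) (subsets N))
length-filter-subsets {N} P? = trans
  (length-filter-++ P? (map (outside ∷_) (subsets N)) _)
  (cong₂ ℕ._+_ (length-filter-map P? (outside ∷_) (subsets N))
               (length-filter-map P? (inside  ∷_) (subsets N)))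

-- A vertex outside `A` is forced out of `W`, and for a vertex of `B` membership is dictated by `I`.
-- Each vertex of `A` outside `B` is free and doubles the count. The inclusions exclude all other
-- combinations of head bits.
length-restricts : (A B I : Subset N) → B ⊆ A → I ⊆ B →
  length (filter (restricts? A B I) (subsets N)) ≡ 2 ^ (∣ A ∣ ∸ ∣ B ∣)
length-restricts [] [] [] _ _ = refl
length-restricts (outside ∷ _) (inside  ∷ _) _            B⊆A _   = case B⊆A here of λ ()
length-restricts _             (outside ∷ _) (inside ∷ _) _   I⊆B = case I⊆B here of λ ()
length-restricts {suc N} A′@(outside ∷ A) B′@(outside ∷ B) I′@(outside ∷ I) B⊆A I⊆B = begin
  length (filter (restricts? A′ B′ I′) (subsets (suc N)))
    ≡⟨ length-filter-subsets (restricts? A′ B′ I′) ⟩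
  _ ≡⟨ cong₂ ℕ._+_ (length-filter-cong _ (restricts? A B I) (λ _ → refl) (subsets N))
                   (length-filter-none _ (λ _ → refl) (subsets N)) ⟩
  length (filter (restricts? A B I) (subsets N)) ℕ.+ 0
    ≡⟨ ℕ.+-identityʳ _ ⟩
  length (filter (restricts? A B I) (subsets N))
    ≡⟨ length-restricts A B I (drop-∷-⊆ B⊆A) (drop-∷-⊆ I⊆B) ⟩
  2 ^ (∣ A ∣ ∸ ∣ B ∣) ∎
  where open ≡-Reasoning
length-restricts {suc N} A′@(inside ∷ A) B′@(outside ∷ B) I′@(outside ∷ I) B⊆A I⊆B = begin
  length (filter (restricts? A′ B′ I′) (subsets (suc N)))
    ≡⟨ length-filter-subsets (restricts? A′ B′ I′) ⟩
  _ ≡⟨ cong₂ ℕ._+_ (length-filter-cong _ (restricts? A B I) (λ _ → refl) (subsets N))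
                   (length-filter-cong _ (restricts? A B I) (λ _ → refl) (subsets N)) ⟩
  length (filter (restricts? A B I) (subsets N)) ℕ.+ length (filter (restricts? A B I) (subsets N))
    ≡⟨ cong (λ k → k ℕ.+ k) (length-restricts A B I (drop-∷-⊆ B⊆A) (drop-∷-⊆ I⊆B)) ⟩
  2 ^ (∣ A ∣ ∸ ∣ B ∣) ℕ.+ 2 ^ (∣ A ∣ ∸ ∣ B ∣)
    ≡⟨ cong (2 ^ (∣ A ∣ ∸ ∣ B ∣) ℕ.+_) (ℕ.+-identityʳ _) ⟨
  2 ^ suc (∣ A ∣ ∸ ∣ B ∣)
    ≡⟨ cong (2 ^_) (ℕ.+-∸-assoc 1 (p⊆q⇒∣p∣≤∣q∣ (drop-∷-⊆ B⊆A))) ⟨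
  2 ^ (suc ∣ A ∣ ∸ ∣ B ∣) ∎
  where open ≡-Reasoning
length-restricts {suc N} A′@(inside ∷ A) B′@(inside ∷ B) I′@(outside ∷ I) B⊆A I⊆B = begin
  length (filter (restricts? A′ B′ I′) (subsets (suc N)))
    ≡⟨ length-filter-subsets (restricts? A′ B′ I′) ⟩
  _ ≡⟨ cong₂ ℕ._+_ (length-filter-cong _ (restricts? A B I) (λ _ → refl) (subsets N))
                   -- The wrong head bit violates the equation with `I`, which is the second
                   -- conjunct; the first stays undetermined, hence `∧-zeroʳ` in place of `refl`.
                   (length-filter-none _ (λ W → ∧-zeroʳ (does (W ⊆? A))) (subsets N)) ⟩
  length (filter (restricts? A B I) (subsets N)) ℕ.+ 0
    ≡⟨ ℕ.+-identityʳ _ ⟩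
  length (filter (restricts? A B I) (subsets N))
    ≡⟨ length-restricts A B I (drop-∷-⊆ B⊆A) (drop-∷-⊆ I⊆B) ⟩
  2 ^ (∣ A ∣ ∸ ∣ B ∣) ∎
  where open ≡-Reasoning
length-restricts {suc N} A′@(inside ∷ A) B′@(inside ∷ B) I′@(inside ∷ I) B⊆A I⊆B = begin
  length (filter (restricts? A′ B′ I′) (subsets (suc N)))
    ≡⟨ length-filter-subsets (restricts? A′ B′ I′) ⟩
  _ ≡⟨ cong₂ ℕ._+_ (length-filter-none _ (λ W → ∧-zeroʳ (does (W ⊆? A))) (subsets N))
                   (length-filter-cong _ (restricts? A B I) (λ _ → refl) (subsets N)) ⟩
  length (filter (restricts? A B I) (subsets N))
    ≡⟨ length-restricts A B I (drop-∷-⊆ B⊆A) (drop-∷-⊆ I⊆B) ⟩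
  2 ^ (∣ A ∣ ∸ ∣ B ∣) ∎
  where open ≡-Reasoning

length-cutsFor : ∀ {N n} → n < N → (I : TerminalSet N n) →
  length (cutsFor I) ≡ 2 ^ (N ∸ n ∸ 1)
length-cutsFor {suc M} {n} (s≤s n≤M) (terminalSet I _ I⊆B) = begin
  length (filter (restricts? (first M) (first n) I) (subsets (suc M)))
    -- The inclusion is an irrelevant field of the terminal set; since it is decidable, `recompute`
    -- yields a usable proof.
    ≡⟨ length-restricts (first M) (first n) I (first-mono n≤M) (recompute (I ⊆? first n) I⊆B) ⟩
  2 ^ (∣ first {suc M} M ∣ ∸ ∣ first {suc M} n ∣)
    ≡⟨ cong₂ (λ a b → 2 ^ (a ∸ b)) (∣first∣ (ℕ.n≤1+n M)) (∣first∣ (ℕ.m≤n⇒m≤1+n n≤M)) ⟩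
  2 ^ (M ∸ n)
    ≡⟨ cong (λ k → 2 ^ (k ∸ 1)) (ℕ.+-∸-assoc 1 n≤M) ⟨
  2 ^ (suc M ∸ n ∸ 1) ∎
  where open ≡-Reasoning

-- Sums in an ordered field

module _ {c ℓ₁ ℓ₂} (F : OrderedField c ℓ₁ ℓ₂) where

  open OrderedField F hiding (refl; sym; trans; reflexive)
  private module F = OrderedField F
  open Network F
  open IsTotalOrder isTotalOrder
    using (total; isPartialOrder; antisym; ≤-respʳ-≈)
    renaming (refl to ≤-refl; reflexive to ≤-reflexive)
  open RingProperties ring using (-1*x≈-x; -‿involutive; +-identityˡ-unique)

  ≤-poset : Poset c ℓ₁ ℓ₂
  ≤-poset = record { isPartialOrder = isPartialOrder }

  open PosetReasoning ≤-poset

  -- If `1# ≤ 0#`, then `- 1#` is nonnegative, and so is its square, which is `1#`.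
  0≤1 : 0# ≤ 1#
  0≤1 with total 0# 1#
  ... | inj₁ 0≤1 = 0≤1
  ... | inj₂ 1≤0 = begin
    0#           ≤⟨ *-nonNeg 0≤-1 0≤-1 ⟩
    - 1# * - 1#  ≈⟨ -1*x≈-x (- 1#) ⟩
    - (- 1#)     ≈⟨ -‿involutive 1# ⟩
    1#           ∎
    where
    0≤-1 : 0# ≤ - 1#
    0≤-1 = begin
      0#         ≈⟨ -‿inverseʳ 1# ⟨
      1# - 1#    ≤⟨ +-monoˡ-≤ (- 1#) 1≤0 ⟩
      0# - 1#    ≈⟨ +-identityˡ (- 1#) ⟩
      - 1#       ∎

  +-mono-≤ : ∀ {x x′ y y′} → x ≤ x′ → y ≤ y′ → x + y ≤ x′ + y′
  +-mono-≤ {x} {x′} {y} {y′} x≤x′ y≤y′ = begin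
    x + y    ≤⟨ +-monoˡ-≤ y x≤x′ ⟩
    x′ + y   ≈⟨ +-comm x′ y ⟩
    y + x′   ≤⟨ +-monoˡ-≤ x′ y≤y′ ⟩
    y′ + x′  ≈⟨ +-comm y′ x′ ⟩
    x′ + y′  ∎

  module _ {a} {A : Set a} where

    ∑-nonNeg : ∀ {f : A → Carrier} → (∀ x → 0# ≤ f x) → ∀ xs → 0# ≤ ∑ xs f
    ∑-nonNeg         0≤f []       = ≤-refl
    ∑-nonNeg {f = f} 0≤f (x ∷ xs) = begin
      0#             ≈⟨ +-identityˡ 0# ⟨
      0# + 0#        ≤⟨ +-mono-≤ (0≤f x) (∑-nonNeg 0≤f xs) ⟩
      f x + ∑ xs f   ∎

    ∑-≤-length : ∀ {f : A → Carrier} → (∀ x → f x ≤ 1#) → ∀ xs → ∑ xs f ≤ fromℕ (length xs)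
    ∑-≤-length f≤1 []       = ≤-refl
    ∑-≤-length f≤1 (x ∷ xs) = +-mono-≤ (f≤1 x) (∑-≤-length f≤1 xs)

    ∑-ones : ∀ {f : A → Carrier} {xs} → All (λ x → f x ≈ 1#) xs → ∑ xs f ≈ fromℕ (length xs)
    ∑-ones []         = F.refl
    ∑-ones (fx ∷ fxs) = +-cong fx (∑-ones fxs)

    -- By uniqueness `x₀` sits at a single position, and every other position contributes `1#`.
    ∑-one-zero : ∀ {f : A → Carrier} {x₀} → f x₀ ≈ 0# → (∀ {x} → x₀ ≢ x → f x ≈ 1#) →
      ∀ {xs} → Unique xs → x₀ ∈ xs → ∑ xs f ≈ fromℕ (length xs ∸ 1)
    ∑-one-zero f₀ f₁ (x₀∉ ∷ _) (here refl) =
      F.trans (+-cong f₀ (∑-ones (All.map f₁ x₀∉))) (+-identityˡ _)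
    -- The tail contains `x₀`, so it has a head; exposing it turns the truncated predecessor of the
    -- length into a successor, from which the `1#` of `x` splits off.
    ∑-one-zero f₀ f₁ {x ∷ _ ∷ _} (x∉ ∷ unique) (there x₀∈) =
      +-cong (f₁ (All.lookup x∉ x₀∈ ∘ sym)) (∑-one-zero f₀ f₁ unique x₀∈)

    -- Equality in the field need not be decidable; the search for a zero only inspects the
    -- alternatives that `binary` supplies.
    zero-or-ones : ∀ {p} {P : Pred A p} {f : A → Carrier} →
      (∀ x → P x → f x ≈ 0# ⊎ f x ≈ 1#) → ∀ {xs} → All P xs →
      (∃[ x ] P x × f x ≈ 0#) ⊎ All (λ x → f x ≈ 1#) xs
    zero-or-ones binary []               = inj₂ []
    zero-or-ones binary {x ∷ _} (px ∷ pxs) with binary x px | zero-or-ones binary pxs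
    ... | inj₁ fx≈0 | _           = inj₁ (x , px , fx≈0)
    ... | inj₂ _    | inj₁ found  = inj₁ found
    ... | inj₂ fx≈1 | inj₂ ones   = inj₂ (fx≈1 ∷ ones)

  -- For positive `m` the two sides differ by one summand `1#`, and the rest cancels. At `m = 0`
  -- truncation would make the premise trivial.
  fromℕ≈fromℕ-pred⇒0≈1 : ∀ {m} → 0 < m → fromℕ m ≈ fromℕ (m ∸ 1) → 0# ≈ 1#
  fromℕ≈fromℕ-pred⇒0≈1 {suc m} _ eq = F.sym (+-identityˡ-unique 1# (fromℕ m) eq)

  module _ {N n : ℕ} (n<N : n < N) (S : TerminalSet N n → Carrier) (w : Weights N) where

    -- From a valid pair to a feasible solution

    module _ (valid : Valid S w) (w≤1 : ∀ e → w e ≤ 1#) where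

      open Valid valid

      -- Several cuts may attain the minimum, but the count allows a single zero; the witness inside
      -- `minimum I` fixes one of them.
      minCut : TerminalSet N n → Subset N
      minCut I = proj₁ (proj₁ (minimum I))

      minCut-cutFor : ∀ I → CutFor I (minCut I)
      minCut-cutFor I = proj₁ (proj₂ (proj₁ (minimum I)))

      S≈minCut : ∀ I → S I ≈ ‖C minCut I ‖ w
      S≈minCut I = proj₂ (proj₂ (proj₁ (minimum I)))

      y : Subset N → TerminalSet N n → Carrier
      y W I = if does (≡-dec _≟ᵇ_ (minCut I) W) then 0# else 1#

      y-minCut : ∀ I → y (minCut I) I ≈ 0#
      y-minCut I rewrite dec-true (≡-dec _≟ᵇ_ (minCut I) (minCut I)) refl = F.refl

      y-other : ∀ I {W} → minCut I ≢ W → y W I ≈ 1#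
      y-other I {W} ≢W rewrite dec-false (≡-dec _≟ᵇ_ (minCut I) W) ≢W = F.refl

      valid⇒ILP : ILP S w y
      valid⇒ILP = record
        { lower  = λ I W cut → proj₂ (minimum I) _ (W , cut , F.refl)
        ; upper  = λ I W _ → upper I W
        ; count  = λ I → F.trans
            (∑-one-zero (y-minCut I) (y-other I)
              (Unique.filter⁺ (cutFor? I) (subsets-unique N))
              (∈-filter⁺ (cutFor? I) (∈-subsets (minCut I)) (minCut-cutFor I)))
            (F.reflexive (cong (λ k → fromℕ (k ∸ 1)) (length-cutsFor n<N I)))
        ; binary = λ I W _ → binary I W
        ; bounds = λ e → nonNeg e , w≤1 e
        }
        where
        upper : ∀ I W → ‖C W ‖ w ≤ S I + fromℕ (∣ W ∣ ℕ.* (N ∸ ∣ W ∣)) * y W I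
        upper I W with ≡-dec _≟ᵇ_ (minCut I) W
        ... | yes refl = ≤-reflexive (F.sym (begin-equality
          S I + _ * 0#  ≈⟨ +-congˡ (zeroʳ _) ⟩
          S I + 0#      ≈⟨ +-identityʳ (S I) ⟩
          S I           ≈⟨ S≈minCut I ⟩
          ‖C W ‖ w      ∎))
        ... | no _ = begin
          ‖C W ‖ w                                       ≤⟨ ∑-≤-length w≤1 (C W) ⟩
          fromℕ (length (C W))                           ≡⟨ cong fromℕ (cut-size W) ⟩
          fromℕ (∣ W ∣ ℕ.* (N ∸ ∣ W ∣))                  ≈⟨ *-identityʳ _ ⟨
          fromℕ (∣ W ∣ ℕ.* (N ∸ ∣ W ∣)) * 1#             ≈⟨ +-identityˡ _ ⟨
          0# + fromℕ (∣ W ∣ ℕ.* (N ∸ ∣ W ∣)) * 1#        ≤⟨ +-monoˡ-≤ _ 0≤S ⟩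
          S I + fromℕ (∣ W ∣ ℕ.* (N ∸ ∣ W ∣)) * 1#       ∎
          where
          0≤S : 0# ≤ S I
          0≤S = ≤-respʳ-≈ (F.sym (S≈minCut I)) (∑-nonNeg nonNeg (C (minCut I)))

        binary : ∀ I W → y W I ≈ 0# ⊎ y W I ≈ 1#
        binary I W with does (≡-dec _≟ᵇ_ (minCut I) W)
        ... | true  = inj₁ F.refl
        ... | false = inj₂ F.refl

    -- From a feasible solution to a valid pair

    module _ {y : Subset N → TerminalSet N n → Carrier} (ilp : ILP S w y) where

      open ILP ilp

      tight : ∀ I {W} → CutFor I W → y W I ≈ 0# → S I ≈ ‖C W ‖ w
      tight I {W} cut y≈0 = antisym (lower I W cut) (begin
        ‖C W ‖ w         ≤⟨ upper I W cut ⟩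
        S I + _ * y W I  ≈⟨ +-congˡ (*-congˡ y≈0) ⟩
        S I + _ * 0#     ≈⟨ +-congˡ (zeroʳ _) ⟩
        S I + 0#         ≈⟨ +-identityʳ (S I) ⟩
        S I              ∎)

      attained : ∀ I → ∃[ W ] CutFor I W × S I ≈ ‖C W ‖ w
      -- `all-filter` equips every entry of `cutsFor I` with the proof of `CutFor I` that `binary`
      -- requires.
      attained I with zero-or-ones (binary I) (all-filter (cutFor? I) (subsets N))
      ... | inj₁ (W , cut , y≈0) = W , cut , tight I cut y≈0
      ... | inj₂ ones = contradiction (fromℕ≈fromℕ-pred⇒0≈1 (ℕ.m^n>0 2 (N ∸ n ∸ 1)) (begin-equality
        fromℕ (2 ^ (N ∸ n ∸ 1))      ≡⟨ cong fromℕ (length-cutsFor n<N I) ⟨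
        fromℕ (length (cutsFor I))   ≈⟨ ∑-ones ones ⟨
        ∑ (cutsFor I) (λ W → y W I)  ≈⟨ count I ⟩
        fromℕ (2 ^ (N ∸ n ∸ 1) ∸ 1)  ∎)) 0≉1

      ILP⇒valid : Valid S w
      ILP⇒valid = record
        { nonNeg  = proj₁ ∘ bounds
        ; minimum = λ I → attained I ,
            λ _ (W , cut , x≈) → ≤-respʳ-≈ (F.sym x≈) (lower I W cut)
        }

proposition9 : ∀ {c ℓ₁ ℓ₂} (F : OrderedField c ℓ₁ ℓ₂) →
    let open OrderedField F in
    let open Network F in
    ∀ (N n : ℕ) → 3 ≤ℕ n → n < N →
    (S : TerminalSet N n → Carrier) (w : Weights N) →
    (Valid S w × (∀ e → w e ≤ 1#)) ⇔ (∃[ y ] ILP S w y)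
proposition9 F N n _ n<N S w = mk⇔
  (λ (valid , w≤1) → y F n<N S w valid w≤1 , valid⇒ILP F n<N S w valid w≤1)
  (λ (_ , ilp) → ILP⇒valid F n<N S w ilp , proj₂ ∘ Network.ILP.bounds ilp)
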